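{- Let $\Gamma=\mathrm{PSL}_2(\mathbb{Z})$, let $S$ be the image of $\begin{pmatrix}0&-1\\1&0\end{pmatrix}$, $T$ the image of $\begin{pmatrix}1&1\\0&1\end{pmatrix}$ and $R=ST$, so that $\Gamma$ is the free product of the cyclic groups $\langle S\rangle$ of order $2$ and $\langle R\rangle$ of order $3$. Let $\phi_1,\phi_2,\phi_3,\phi_4\colon\Gamma\to S_7$ be the homomorphisms determined by $\phi_1(S)=(12)(34)(56)$, $\phi_1(R)=(235)(467)$; $\phi_2(S)=(12)(34)(56)$, $\phi_2(R)=(235)(764)$; $\phi_3(S)=(12)(34)(67)$, $\phi_3(R)=(235)(467)$; $\phi_4(S)=(12)(34)(67)$, $\phi_4(R)=(253)(467)$. For $j=1,\dots,7$ let $G_j=\phi_1^{ -1}(\mathrm{Stab}(j))$, $H_j=\phi_2^{ -1}(\mathrm{Stab}(j))$, $U_j=\phi_3^{ -1}(\mathrm{Stab}(j))$, $V_j=\phi_4^{ -1}(\mathrm{Stab}(j))$, where $\mathrm{Stab}(j)$ is the stabilizer of $j$ in the image of the respective homomorphism. Then every subgroup of $\Gamma$ of index less than $7$ is a congruence subgroup, and the noncongruence subgroups of $\Gamma$ of index $7$ are exactly the groups $G_j,H_j,U_j,V_j$ for $j=1,\dots,7$ (in particular, each of these groups is noncongruence).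
   Context: Permutations in $S_7$ are composed as functions, right to left. A subgroup of $\Gamma$ is congruence if it contains the image of some principal congruence subgroup $\Gamma(N)$, and noncongruence otherwise. -}

module Defs where

open import Data.Nat as ℕ using (ℕ)
open import Data.Integer using (ℤ; +_; -_; _+_; _-_; _*_; 0ℤ; 1ℤ; -1ℤ)
open import Data.Integer.Divisibility using (_∣_)
open import Data.Integer.Solver using (module +-*-Solver)
open import Data.Fin using (Fin; #_)
open import Data.Vec using (Vec; []; _∷_; lookup)
open import Data.Product using (Σ; ∃; _×_; _,_; proj₁)
open import Relation.Binary.PropositionalEquality
open import Relation.Nullary using (¬_)

record Mat : Set where
  constructor mat
  field
    a b c d : ℤ
open Mat public

det : Mat → ℤ
det m = a m * d m - b m * c m

_·ₘ_ : Mat → Mat → Mat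
mat a₁ b₁ c₁ d₁ ·ₘ mat a₂ b₂ c₂ d₂ =
  mat (a₁ * a₂ + b₁ * c₂) (a₁ * b₂ + b₁ * d₂)
      (c₁ * a₂ + d₁ * c₂) (c₁ * b₂ + d₁ * d₂)

det-mul : ∀ m n → det (m ·ₘ n) ≡ det m * det n
det-mul (mat a₁ b₁ c₁ d₁) (mat a₂ b₂ c₂ d₂) =
  solve 8 (λ a₁ b₁ c₁ d₁ a₂ b₂ c₂ d₂ →
    (a₁ :* a₂ :+ b₁ :* c₂) :* (c₁ :* b₂ :+ d₁ :* d₂)
      :- (a₁ :* b₂ :+ b₁ :* d₂) :* (c₁ :* a₂ :+ d₁ :* c₂)
    := (a₁ :* d₁ :- b₁ :* c₁) :* (a₂ :* d₂ :- b₂ :* c₂))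
    refl a₁ b₁ c₁ d₁ a₂ b₂ c₂ d₂
  where open +-*-Solver

adj : Mat → Mat
adj (mat a b c d) = mat d (- b) (- c) a

det-adj : ∀ m → det (adj m) ≡ det m
det-adj (mat a b c d) =
  solve 4 (λ a b c d → d :* a :- (:- b) :* (:- c) := a :* d :- b :* c)
    refl a b c d
  where open +-*-Solver

negₘ : Mat → Mat
negₘ (mat a b c d) = mat (- a) (- b) (- c) (- d)

det-neg : ∀ m → det (negₘ m) ≡ det m
det-neg (mat a b c d) =
  solve 4 (λ a b c d → (:- a) :* (:- d) :- (:- b) :* (:- c) := a :* d :- b :* c)
    refl a b c d
  where open +-*-Solver

SL2 : Set
SL2 = Σ Mat (λ m → det m ≡ 1ℤ)

_·_ : SL2 → SL2 → SL2
(m , p) · (n , q) = m ·ₘ n , trans (det-mul m n) (cong₂ _*_ p q)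

inv : SL2 → SL2
inv (m , p) = adj m , trans (det-adj m) p

neg : SL2 → SL2
neg (m , p) = negₘ m , trans (det-neg m) p

I₂ : SL2
I₂ = mat 1ℤ 0ℤ 0ℤ 1ℤ , refl

_≈_ : SL2 → SL2 → Set
A ≈ B = proj₁ A ≡ proj₁ B

Sₘ : SL2
Sₘ = mat 0ℤ -1ℤ 1ℤ 0ℤ , refl

Tₘ : SL2
Tₘ = mat 1ℤ 1ℤ 0ℤ 1ℤ , refl

Rₘ : SL2
Rₘ = Sₘ · Tₘ

-- Γ = PSL₂(ℤ) = SL₂(ℤ)/{±I}.  Subgroups of Γ are represented by their
-- preimages in SL₂(ℤ), i.e. subgroups of SL₂(ℤ) containing -I
-- (equivalently, closed under A ↦ -A).

record IsSubgroupΓ (H : SL2 → Set) : Set where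
  field
    resp-∈ : ∀ {A B} → A ≈ B → H A → H B
    neg-∈ : ∀ {A} → H A → H (neg A)
    id-∈  : H I₂
    mul-∈ : ∀ {A B} → H A → H B → H (A · B)
    inv-∈ : ∀ {A} → H A → H (inv A)

-- [Γ : H] = n : the left cosets A H are in bijection with Fin n,
-- via f with  f A ≡ f B  ⇔  A⁻¹ B ∈ H, and f surjective.
HasIndex : (SL2 → Set) → ℕ → Set
HasIndex H n =
  Σ (SL2 → Fin n) λ f →
    (∀ A B → (f A ≡ f B → H (inv A · B)) × (H (inv A · B) → f A ≡ f B))
    × (∀ i → ∃ λ A → f A ≡ i)

InΓ : ℕ → SL2 → Set
InΓ N (mat a b c d , _) =
  (+ N ∣ (a - 1ℤ)) × (+ N ∣ b) × (+ N ∣ c) × (+ N ∣ (d - 1ℤ))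

IsCongruence : (SL2 → Set) → Set
IsCongruence H = ∃ λ N → (1 ℕ.≤ N) × (∀ A → InΓ N A → H A)

-- Homomorphisms Γ → S₇.  S₇ acts on Fin 7, where the point j ∈ {1,…,7}
-- of the paper is  # (j - 1).  Composition is right to left:
-- φ (A B) j = φ A (φ B j).  Factoring through Γ means φ(-A) = φ(A).

record IsHomΓ (σ ρ : Fin 7 → Fin 7) (φ : SL2 → Fin 7 → Fin 7) : Set where
  field
    resp-φ  : ∀ {A B} → A ≈ B → ∀ j → φ A j ≡ φ B j
    hom     : ∀ A B j → φ (A · B) j ≡ φ A (φ B j)
    neg-inv : ∀ A j → φ (neg A) j ≡ φ A j
    on-S    : ∀ j → φ Sₘ j ≡ σ j
    on-R    : ∀ j → φ Rₘ j ≡ ρ j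

StabPre : (SL2 → Fin 7 → Fin 7) → Fin 7 → SL2 → Set
StabPre φ j A = φ A j ≡ j

_≐_ : (SL2 → Set) → (SL2 → Set) → Set
H ≐ K = ∀ A → (H A → K A) × (K A → H A)

permOf : Vec (Fin 7) 7 → Fin 7 → Fin 7
permOf v = lookup v

-- σ₁ = (12)(34)(56)
σ₁ : Fin 7 → Fin 7
σ₁ = permOf (# 1 ∷ # 0 ∷ # 3 ∷ # 2 ∷ # 5 ∷ # 4 ∷ # 6 ∷ [])
-- ρ₁ = (235)(467) : 1↦1,2↦3,3↦5,4↦6,5↦2,6↦7,7↦4
ρ₁ : Fin 7 → Fin 7
ρ₁ = permOf (# 0 ∷ # 2 ∷ # 4 ∷ # 5 ∷ # 1 ∷ # 6 ∷ # 3 ∷ [])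
-- ρ₂ = (235)(764) : 1↦1,2↦3,3↦5,4↦7,5↦2,6↦4,7↦6
ρ₂ : Fin 7 → Fin 7
ρ₂ = permOf (# 0 ∷ # 2 ∷ # 4 ∷ # 6 ∷ # 1 ∷ # 3 ∷ # 5 ∷ [])
-- σ₃ = (12)(34)(67)
σ₃ : Fin 7 → Fin 7
σ₃ = permOf (# 1 ∷ # 0 ∷ # 3 ∷ # 2 ∷ # 4 ∷ # 6 ∷ # 5 ∷ [])
-- ρ₄ = (253)(467) : 1↦1,2↦5,3↦2,4↦6,5↦3,6↦7,7↦4
ρ₄ : Fin 7 → Fin 7
ρ₄ = permOf (# 0 ∷ # 4 ∷ # 1 ∷ # 5 ∷ # 2 ∷ # 6 ∷ # 3 ∷ [])

{-# OPTIONS --safe #-}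

-- A subgroup of index n ≤ 7 is the stabiliser of a point in a transitive action of Γ = C₂ * C₃ on n points,
-- that is, a connected Schreier graph on S and R with a base vertex.  Such graphs are enumerated by the
-- low-index-subgroups search: starting from the base vertex, repeatedly take an edge whose end is unknown and
-- let it lead to each known vertex or to a new one, discarding graphs that violate S² = R³ = 1.  Each complete
-- graph either is one of the four given actions with some base point, or is congruence: it then receives
-- an equivariant map from SL₂(ℤ/N), where N is the order of T, so Γ(N) fixes the base vertex.
--
-- For noncongruence let T^x = (1 x; 0 1) and L^y = (1 0; -y 1).  They commute modulo xy, so if Γ(N) lies in a
-- point stabiliser of a transitive action, T^x and L^y act by commuting permutations whenever N ∣ xy.  Every N
-- divides such a product with x ≡ 16 and y ≡ 15 modulo 60, a multiple of the order of T in all four actions,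
-- but T¹⁶ and L¹⁵ do not commute in any of them.
module Submission where

open import Defs
open import Data.Bool using (true; if_then_else_)
open import Data.Empty using (⊥)
open import Data.Fin as Fin using (Fin; #_)
import Data.Fin.Properties as Fin
open import Data.Integer as ℤ using (ℤ; +_; -[1+_]; -_; _+_; _-_; _*_; 0ℤ; 1ℤ; -1ℤ; ∣_∣)
open import Data.Integer.Divisibility using (_∣_)
open import Data.Integer.Divisibility.Signed as ℤ using () renaming (_∣_ to _∣ₛ_)
import Data.Integer.DivMod as ℤ
import Data.Integer.Properties as ℤ
open import Data.Integer.Tactic.RingSolver using (solve-∀)
open import Data.List using (List; []; _∷_; _++_; foldr; length; map; filter; head; upTo; lookup)
import Data.List.Membership.DecPropositional as DecMembership
open import Data.List.Membership.Propositional as Membership using (_∈_)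
open import Data.List.Membership.Propositional.Properties using (∈-lookup)
import Data.List.Properties as List
open import Data.List.Relation.Unary.All as All using (All; []; _∷_)
import Data.List.Relation.Unary.All.Properties as All
open import Data.List.Relation.Unary.AllPairs as AllPairs using (AllPairs; []; _∷_)
open import Data.List.Relation.Unary.Any as Any using (here; there)
open import Data.Maybe using (Maybe; just; nothing; fromMaybe; is-just)
import Data.Maybe.Properties as Maybe
import Data.Maybe.Relation.Unary.All as Maybe
open import Data.Nat as ℕ using (ℕ; zero; suc; _<_; _≤_; _≤?_; _<?_; _≡ᵇ_; s≤s; z≤n)
import Data.Nat.Divisibility as ℕ
open import Data.Nat.DivMod using (_%_; m%n<n; m≡m%n+[m/n]*n)
open import Data.Nat.GeneralisedArithmetic using (fold; fold-+)
import Data.Nat.Properties as ℕ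
import Data.Nat.Tactic.RingSolver as ℕ
open import Data.Product using (∃; _×_; _,_; proj₁; proj₂)
open import Data.Sum using (_⊎_; inj₁; inj₂; [_,_]′)
open import Data.Vec as Vec using (Vec; []; _∷_)
open import Function using (_∘_; id)
open import Relation.Binary.Definitions using (DecidableEquality)
open import Relation.Binary.PropositionalEquality
open import Relation.Nullary using (¬_; Dec; yes; no; does; ¬?; contradiction; _×-dec_; _→-dec_; _⊎-dec_)
open import Relation.Nullary.Decidable using (map′)

-- Identities for two-by-two matrices

mat-cong : ∀ {a a′ b b′ c c′ d d′} → a ≡ a′ → b ≡ b′ → c ≡ c′ → d ≡ d′ → mat a b c d ≡ mat a′ b′ c′ d′
mat-cong refl refl refl refl = refl

·ₘ-assoc : ∀ l m n → (l ·ₘ m) ·ₘ n ≡ l ·ₘ (m ·ₘ n)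
·ₘ-assoc (mat a₁ b₁ c₁ d₁) (mat a₂ b₂ c₂ d₂) (mat a₃ b₃ c₃ d₃) =
  mat-cong (entry a₁ b₁ a₂ b₂ c₂ d₂ a₃ c₃) (entry a₁ b₁ a₂ b₂ c₂ d₂ b₃ d₃)
           (entry c₁ d₁ a₂ b₂ c₂ d₂ a₃ c₃) (entry c₁ d₁ a₂ b₂ c₂ d₂ b₃ d₃)
  where
  entry : ∀ x y a b c d z w → (x * a + y * c) * z + (x * b + y * d) * w ≡ x * (a * z + b * w) + y * (c * z + d * w)
  entry = solve-∀

·ₘ-identityˡ : ∀ m → proj₁ I₂ ·ₘ m ≡ m
·ₘ-identityˡ (mat a b c d) = mat-cong (top a c) (top b d) (bottom a c) (bottom b d)
  where
  top : ∀ x y → 1ℤ * x + 0ℤ * y ≡ x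
  top = solve-∀
  bottom : ∀ x y → 0ℤ * x + 1ℤ * y ≡ y
  bottom = solve-∀

adj-·ₘ : ∀ m n → adj (m ·ₘ n) ≡ adj n ·ₘ adj m
adj-·ₘ (mat a₁ b₁ c₁ d₁) (mat a₂ b₂ c₂ d₂) =
  mat-cong (diagonal c₁ b₂ d₁ d₂) (off a₁ b₂ b₁ d₂) (off′ c₁ a₂ d₁ c₂) (diagonal′ a₁ a₂ b₁ c₂)
  where
  diagonal : ∀ x y z w → x * y + z * w ≡ w * z + (- y) * (- x)
  diagonal = solve-∀
  off : ∀ x y z w → - (x * y + z * w) ≡ w * (- z) + (- y) * x
  off = solve-∀
  off′ : ∀ x y z w → - (x * y + z * w) ≡ (- w) * z + y * (- x)
  off′ = solve-∀
  diagonal′ : ∀ x y z w → x * y + z * w ≡ (- w) * (- z) + y * x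
  diagonal′ = solve-∀

adj-inverseˡ : ∀ m → adj m ·ₘ m ≡ mat (det m) 0ℤ 0ℤ (det m)
adj-inverseˡ (mat a b c d) = mat-cong (diagonal a b c d) (vanish b d) (vanish′ a c) (diagonal′ a b c d)
  where
  diagonal : ∀ a b c d → d * a + (- b) * c ≡ a * d - b * c
  diagonal = solve-∀
  diagonal′ : ∀ a b c d → (- c) * b + a * d ≡ a * d - b * c
  diagonal′ = solve-∀
  vanish : ∀ b d → d * b + (- b) * d ≡ 0ℤ
  vanish = solve-∀
  vanish′ : ∀ a c → (- c) * a + a * c ≡ 0ℤ
  vanish′ = solve-∀

inverseˡ : ∀ A → (inv A · A) ≈ I₂
inverseˡ (m , p) = trans (adj-inverseˡ m) (cong (λ x → mat x 0ℤ 0ℤ x) p)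

adj-negₘ-·ₘ : ∀ m → adj (negₘ m) ·ₘ m ≡ negₘ (adj m ·ₘ m)
adj-negₘ-·ₘ (mat a b c d) = mat-cong (e₁ a b c d) (e₁ b b d d) (e₂ a a c c) (e₂ a b c d)
  where
  e₁ : ∀ a b c d → (- d) * a + (- (- b)) * c ≡ - (d * a + (- b) * c)
  e₁ = solve-∀
  e₂ : ∀ a b c d → (- (- c)) * b + (- a) * d ≡ - ((- c) * b + a * d)
  e₂ = solve-∀

-- This makes left multiplication by `C` well defined on left cosets, so that S and R act on them.
·-cancel-inv : ∀ C A B → (inv (C · A) · (C · B)) ≈ (inv A · B)
·-cancel-inv C@(c , _) A@(a , _) B@(b , _) = begin
  adj (c ·ₘ a) ·ₘ (c ·ₘ b)      ≡⟨ cong (_·ₘ (c ·ₘ b)) (adj-·ₘ c a) ⟩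
  (adj a ·ₘ adj c) ·ₘ (c ·ₘ b)  ≡⟨ ·ₘ-assoc (adj a) (adj c) (c ·ₘ b) ⟩
  adj a ·ₘ (adj c ·ₘ (c ·ₘ b))  ≡⟨ cong (adj a ·ₘ_) (·ₘ-assoc (adj c) c b) ⟨
  adj a ·ₘ ((adj c ·ₘ c) ·ₘ b)  ≡⟨ cong (λ x → adj a ·ₘ (x ·ₘ b)) (inverseˡ C) ⟩
  adj a ·ₘ (proj₁ I₂ ·ₘ b)      ≡⟨ cong (adj a ·ₘ_) (·ₘ-identityˡ b) ⟩
  adj a ·ₘ b                    ∎
  where open ≡-Reasoning

S²·ₘ : ∀ m → proj₁ Sₘ ·ₘ (proj₁ Sₘ ·ₘ m) ≡ negₘ m
S²·ₘ (mat a b c d) = mat-cong (top a c) (top b d) (bottom a c) (bottom b d)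
  where
  top : ∀ x y → 0ℤ * (0ℤ * x + -1ℤ * y) + -1ℤ * (1ℤ * x + 0ℤ * y) ≡ - x
  top = solve-∀
  bottom : ∀ x y → 1ℤ * (0ℤ * x + -1ℤ * y) + 0ℤ * (1ℤ * x + 0ℤ * y) ≡ - y
  bottom = solve-∀

R³·ₘ : ∀ m → proj₁ Rₘ ·ₘ (proj₁ Rₘ ·ₘ (proj₁ Rₘ ·ₘ m)) ≡ negₘ m
R³·ₘ m = begin
  r ·ₘ (r ·ₘ (r ·ₘ m))  ≡⟨ ·ₘ-assoc r r (r ·ₘ m) ⟨
  (r ·ₘ r) ·ₘ (r ·ₘ m)  ≡⟨ ·ₘ-assoc (r ·ₘ r) r m ⟨
  -- R³ and S² both evaluate to -I.
  ((r ·ₘ r) ·ₘ r) ·ₘ m  ≡⟨⟩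
  (s ·ₘ s) ·ₘ m         ≡⟨ ·ₘ-assoc s s m ⟩
  s ·ₘ (s ·ₘ m)         ≡⟨ S²·ₘ m ⟩
  negₘ m                ∎
  where
  open ≡-Reasoning
  r = proj₁ Rₘ
  s = proj₁ Sₘ

-- Words in S and R

data Letter : Set where
  S R : Letter

Word : Set
Word = List Letter

_≟ˡ_ : DecidableEquality Letter
S ≟ˡ S = yes refl
S ≟ˡ R = no λ ()
R ≟ˡ S = no λ ()
R ≟ˡ R = yes refl

_≟ʷ_ : DecidableEquality Word
_≟ʷ_ = List.≡-dec _≟ˡ_

open DecMembership _≟ʷ_ using () renaming (_∈?_ to _∈ʷ?_)

⟦_⟧ˡ : Letter → SL2
⟦ S ⟧ˡ = Sₘ
⟦ R ⟧ˡ = Rₘ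

⟦_⟧ : Word → SL2
⟦ [] ⟧    = I₂
⟦ g ∷ w ⟧ = ⟦ g ⟧ˡ · ⟦ w ⟧

⟦⟧-++ : ∀ u v → ⟦ u ++ v ⟧ ≈ (⟦ u ⟧ · ⟦ v ⟧)
⟦⟧-++ []      v = sym (·ₘ-identityˡ _)
⟦⟧-++ (g ∷ u) v = trans (cong (proj₁ ⟦ g ⟧ˡ ·ₘ_) (⟦⟧-++ u v)) (sym (·ₘ-assoc (proj₁ ⟦ g ⟧ˡ) (proj₁ ⟦ u ⟧) _))

-- Generation of SL₂(ℤ) by S and R

Generated : Mat → Set
Generated m = ∃ λ w → proj₁ ⟦ w ⟧ ≡ m

generated-· : ∀ {m n} → Generated m → Generated n → Generated (m ·ₘ n)
generated-· (u , p) (v , q) = u ++ v , trans (⟦⟧-++ u v) (cong₂ _·ₘ_ p q)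

upper lower : ℤ → SL2
upper k = mat 1ℤ k 0ℤ 1ℤ , lem k
  where
  lem : ∀ k → 1ℤ * 1ℤ - k * 0ℤ ≡ 1ℤ
  lem = solve-∀
lower k = mat 1ℤ 0ℤ k 1ℤ , refl

upper-+ : ∀ k l → (upper k · upper l) ≈ upper (k + l)
upper-+ k l = mat-cong (e₁ k) (e₂ k l) refl (e₃ l)
  where
  e₁ : ∀ k → 1ℤ * 1ℤ + k * 0ℤ ≡ 1ℤ
  e₁ = solve-∀
  e₂ : ∀ k l → 1ℤ * l + k * 1ℤ ≡ k + l
  e₂ = solve-∀
  e₃ : ∀ l → 0ℤ * l + 1ℤ * 1ℤ ≡ 1ℤ
  e₃ = solve-∀

lower-+ : ∀ k l → (lower k · lower l) ≈ lower (k + l)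
lower-+ k l = mat-cong refl refl (e₂ k l) (e₃ k)
  where
  e₂ : ∀ k l → k * 1ℤ + 1ℤ * l ≡ k + l
  e₂ = solve-∀
  e₃ : ∀ k → k * 0ℤ + 1ℤ * 1ℤ ≡ 1ℤ
  e₃ = solve-∀

generated-upper : ∀ k → Generated (proj₁ (upper k))
generated-upper (+ zero)      = [] , refl
-- S³ = S⁻¹ in SL₂(ℤ), so S³R = S⁻¹ST = T.
generated-upper (+ suc n)     = let w , p = generated-· (S ∷ S ∷ S ∷ R ∷ [] , refl) (generated-upper (+ n)) in
  w , trans p (upper-+ 1ℤ (+ n))
-- T⁻¹ = R⁻¹S; since R³ = S² = -I, the signs in R² = -R⁻¹ and S³ = -S cancel.
generated-upper (-[1+ zero ])  = R ∷ R ∷ S ∷ S ∷ S ∷ [] , refl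
generated-upper (-[1+ suc n ]) = let w , p = generated-· (generated-upper -1ℤ) (generated-upper -[1+ n ]) in
  w , trans p (upper-+ -1ℤ -[1+ n ])

unit-cases : ∀ x y → x * y ≡ 1ℤ → (x ≡ 1ℤ × y ≡ 1ℤ) ⊎ (x ≡ -1ℤ × y ≡ -1ℤ)
unit-cases x y xy≡1 = go x y (ℕ.m*n≡1⇒m≡1 ∣ x ∣ ∣ y ∣ ∣x∣∣y∣≡1) (ℕ.m*n≡1⇒n≡1 ∣ x ∣ ∣ y ∣ ∣x∣∣y∣≡1) xy≡1
  where
  ∣x∣∣y∣≡1 = trans (sym (ℤ.abs-* x y)) (cong ∣_∣ xy≡1)
  go : ∀ x y → ∣ x ∣ ≡ 1 → ∣ y ∣ ≡ 1 → x * y ≡ 1ℤ → (x ≡ 1ℤ × y ≡ 1ℤ) ⊎ (x ≡ -1ℤ × y ≡ -1ℤ)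
  go (+ _)    (+ _)    refl refl _ = inj₁ (refl , refl)
  go -[1+ _ ] -[1+ _ ] refl refl _ = inj₂ (refl , refl)
  go (+ _)    -[1+ _ ] refl refl ()
  go -[1+ _ ] (+ _)    refl refl ()

negₘ-involutive : ∀ m → negₘ (negₘ m) ≡ m
negₘ-involutive (mat a b c d) =
  mat-cong (ℤ.neg-involutive a) (ℤ.neg-involutive b) (ℤ.neg-involutive c) (ℤ.neg-involutive d)

generated-S· : ∀ {m} → Generated (proj₁ Sₘ ·ₘ m) → Generated m
generated-S· {m} (w , p) = S ∷ S ∷ S ∷ w ,
  trans (cong (λ x → s ·ₘ (s ·ₘ (s ·ₘ x))) p)
    (trans (S²·ₘ (s ·ₘ (s ·ₘ m))) (trans (cong negₘ (S²·ₘ m)) (negₘ-involutive m)))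
  where s = proj₁ Sₘ

generated-upper· : ∀ k {m} → Generated (proj₁ (upper k) ·ₘ m) → Generated m
generated-upper· k {m} g = let w , p = generated-· (generated-upper (- k)) g in
  w , trans p (trans (sym (·ₘ-assoc (proj₁ (upper (- k))) (proj₁ (upper k)) m))
    (trans (cong (_·ₘ m) (trans (upper-+ (- k) k) (cong (λ x → mat 1ℤ x 0ℤ 1ℤ) (ℤ.+-inverseˡ k))))
      (·ₘ-identityˡ m)))

-- Here ad = 1 forces a = d = ±1, so the matrix is a power of T up to sign, and the word SS supplies
-- the sign.
generated-triangular : ∀ m → det m ≡ 1ℤ → c m ≡ 0ℤ → Generated m
generated-triangular (mat a b _ d) det≡1 refl with unit-cases a d (trans (lem a b d) det≡1)
  where
  lem : ∀ a b d → a * d ≡ a * d - b * 0ℤ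
  lem = solve-∀
... | inj₁ (refl , refl) = generated-upper b
... | inj₂ (refl , refl) = let w , p = generated-upper (- b) in
  S ∷ S ∷ w , trans (S²·ₘ (proj₁ ⟦ w ⟧)) (trans (cong negₘ p) (cong (λ x → mat -1ℤ x 0ℤ -1ℤ) (ℤ.neg-involutive b)))

-- Euclid's algorithm on the first column.
generated : ∀ A → Generated (proj₁ A)
generated A = go (suc ∣ c (proj₁ A) ∣) A ℕ.≤-refl
  where
  go : ∀ n A → ∣ c (proj₁ A) ∣ < n → Generated (proj₁ A)
  go (suc n) A@(mat a b c d , det≡1) (s≤s ∣c∣≤n) with c ℤ.≟ 0ℤ
  ... | yes c≡0 = generated-triangular _ det≡1 c≡0
  -- T^(-q) replaces a by the remainder a - qc, and S moves it to the lower left corner, where its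
  -- size is less than ∣c∣.
  ... | no  c≢0 = generated-upper· (- q) (generated-S· (go n (Sₘ · (upper (- q) · A))
                    (ℕ.<-≤-trans (subst (_< ∣ c ∣) (sym (cong ∣_∣ entry)) (ℤ.n%d<d a c)) ∣c∣≤n)))
    where
    instance _ = ℤ.≢-nonZero c≢0
    q = a ℤ./ c
    expand : ∀ a c q → 1ℤ * (1ℤ * a + (- q) * c) + 0ℤ * (0ℤ * a + 1ℤ * c) ≡ a - q * c
    expand = solve-∀
    cancel : ∀ r s → (r + s) - s ≡ r
    cancel = solve-∀
    entry : 1ℤ * (1ℤ * a + (- q) * c) + 0ℤ * (0ℤ * a + 1ℤ * c) ≡ + (a ℤ.% c)
    entry = trans (expand a c q) (trans (cong (_- q * c) (ℤ.a≡a%n+[a/n]*n a c)) (cancel (+ (a ℤ.% c)) (q * c)))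

-- Schreier graphs

Rules : Set
Rules = List (Word × Word)

-- An unknown edge `g ∷ v` has no rule and is returned unchanged; in the search such a word is not
-- in V, which is how gaps are recognised.
reduce : Rules → Word → Word
reduce []            u = u
reduce ((x , y) ∷ E) u = if does (u ≟ʷ x) then y else reduce E u

reduceAll : Rules → Word → Word → Word
reduceAll E v = foldr (λ g x → reduce E (g ∷ x)) v

relators : List Word
relators = (S ∷ S ∷ []) ∷ (R ∷ R ∷ R ∷ []) ∷ []

-- A partial Schreier graph: V are representatives of distinct cosets, and a rule (g ∷ u , v) of E
-- with u , v ∈ V is an edge labelled g from the coset of u to that of v.
record Realises {X : Set} (F : Word → X) (V : List Word) (E : Rules) : Set where
  constructor realises
  field
    distinct : AllPairs (λ u v → F u ≢ F v) V
    sound    : All (λ (u , v) → F u ≡ F v) E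

-- A relator path that meets an unknown edge ends outside V and imposes no condition yet.
Consistent : List Word → Rules → Set
Consistent V E = All (λ v → All (λ r → reduceAll E v r ∈ V → reduceAll E v r ≡ v) relators) V

Complete : List Word → Rules → Set
Complete V E = [] ∈ V × All (λ v → reduce E (S ∷ v) ∈ V × reduce E (R ∷ v) ∈ V) V

missingEdges : List Word → Rules → List Word
missingEdges V E = filter (λ u → ¬? (reduce E u ∈ʷ? V)) (map (R ∷_) V ++ map (S ∷_) V)

realises? : ∀ {X : Set} → DecidableEquality X → (F : Word → X) → ∀ V E → Dec (Realises F V E)
realises? _≟_ F V E = map′ (λ (p , q) → realises p q) (λ (realises p q) → p , q)
  (AllPairs.allPairs? (λ u v → ¬? (F u ≟ F v)) V ×-dec All.all? (λ (u , v) → F u ≟ F v) E)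

consistent? : ∀ V E → Dec (Consistent V E)
consistent? V E = All.all? (λ v → All.all? (λ r → (reduceAll E v r ∈ʷ? V) →-dec (reduceAll E v r ≟ʷ v)) relators) V

complete? : ∀ V E → Dec (Complete V E)
complete? V E = ([] ∈ʷ? V) ×-dec All.all? (λ v → (reduce E (S ∷ v) ∈ʷ? V) ×-dec (reduce E (R ∷ v) ∈ʷ? V)) V

-- The property of an orbit map w ↦ w·x that the graph lemmas use; they apply to the cosets of a
-- subgroup and to the four given actions alike.
LeftCongruent : {X : Set} → (Word → X) → Set
LeftCongruent F = ∀ g {u v} → F u ≡ F v → F (g ∷ u) ≡ F (g ∷ v)

KillsRelators : {X : Set} → (Word → X) → Set
KillsRelators F = All (λ r → ∀ v → F (r ++ v) ≡ F v) relators

module _ {X : Set} {F : Word → X} {V : List Word} {E : Rules}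
         (F-cong : LeftCongruent F) (real : Realises F V E) where
  open Realises real

  injective : ∀ {u v} → u ∈ V → v ∈ V → F u ≡ F v → u ≡ v
  injective = go distinct
    where
    go : ∀ {W u v} → AllPairs (λ u v → F u ≢ F v) W → u ∈ W → v ∈ W → F u ≡ F v → u ≡ v
    go (p ∷ ps) (here refl) (here refl) _  = refl
    go (p ∷ ps) (here refl) (there v∈)  eq = contradiction eq (All.lookup p v∈)
    go (p ∷ ps) (there u∈)  (here refl) eq = contradiction (sym eq) (All.lookup p u∈)
    go (p ∷ ps) (there u∈)  (there v∈)  eq = go ps u∈ v∈ eq

  reduce-sound : ∀ u → F u ≡ F (reduce E u)
  reduce-sound u = go E sound
    where
    go : ∀ E → All (λ (x , y) → F x ≡ F y) E → F u ≡ F (reduce E u)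
    go []            []       = refl
    go ((x , y) ∷ E) (p ∷ ps) with u ≟ʷ x
    ... | yes refl = p
    ... | no  _    = go E ps

  reduceAll-sound : ∀ v w → F (w ++ v) ≡ F (reduceAll E v w)
  reduceAll-sound v []      = refl
  reduceAll-sound v (g ∷ w) = trans (F-cong g (reduceAll-sound v w)) (reduce-sound (g ∷ reduceAll E v w))

  -- Following a relator from v leads back to the coset of v, and V contains at most one word per
  -- coset.
  consistent : KillsRelators F → Consistent V E
  consistent kills = All.tabulate λ {v} v∈V → All.map
    (λ {r} kill r∈V → injective r∈V v∈V (trans (sym (reduceAll-sound v r)) (kill v))) kills

  normalForm-∈ : Complete V E → ∀ w → reduceAll E [] w ∈ V
  normalForm-∈ (base , edges) []      = base
  normalForm-∈ (base , edges) (S ∷ w) = proj₁ (All.lookup edges (normalForm-∈ (base , edges) w))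
  normalForm-∈ (base , edges) (R ∷ w) = proj₂ (All.lookup edges (normalForm-∈ (base , edges) w))

  normalForm-sound : ∀ w → F w ≡ F (reduceAll E [] w)
  normalForm-sound w = trans (cong F (sym (List.++-identityʳ w))) (reduceAll-sound [] w)

  -- Normal forms are computed from E alone. With the converse below, two maps realising the same
  -- complete graph therefore have the same words fixing the base vertex.
  fixes⇒normalForm : Complete V E → ∀ w → F w ≡ F [] → reduceAll E [] w ≡ []
  fixes⇒normalForm complete w eq =
    injective (normalForm-∈ complete w) (proj₁ complete) (trans (sym (normalForm-sound w)) eq)

  normalForm⇒fixes : ∀ w → reduceAll E [] w ≡ [] → F w ≡ F []
  normalForm⇒fixes w eq = trans (normalForm-sound w) (cong F eq)

length≤ : ∀ {n V E} {F : Word → Fin n} → Realises F V E → length V ≤ n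
length≤ {n} {V} {F = F} real with length V ≤? n
... | yes p = p
... | no ¬p with i , j , i<j , eq ← Fin.pigeonhole (ℕ.≰⇒> ¬p) (F ∘ lookup V) =
  contradiction eq (go (Realises.distinct real) i<j)
  where
  go : ∀ {W i j} → AllPairs (λ u v → F u ≢ F v) W → i Fin.< j → F (lookup W i) ≢ F (lookup W j)
  go {i = Fin.zero}  {Fin.suc j} (p ∷ _)  _       = All.lookup p (∈-lookup j)
  go {i = Fin.suc i} {Fin.suc j} (_ ∷ ps) (s≤s q) = go ps q

orbit : (Fin 7 → Fin 7) → (Fin 7 → Fin 7) → Fin 7 → Word → Fin 7
orbit σ ρ j = foldr (λ { S → σ ; R → ρ }) j

orbit-cong : ∀ σ ρ j → LeftCongruent (orbit σ ρ j)
orbit-cong σ ρ j S = cong σ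
orbit-cong σ ρ j R = cong ρ

σᵗ ρᵗ : Fin 4 → Fin 7 → Fin 7
σᵗ = Vec.lookup (σ₁ ∷ σ₁ ∷ σ₃ ∷ σ₃ ∷ [])
ρᵗ = Vec.lookup (ρ₁ ∷ ρ₂ ∷ ρ₁ ∷ ρ₄ ∷ [])

-- The bound on `length V` yields 7 ≤ n for a subgroup of index n, which excludes this case in
-- smaller index.
Exceptional : List Word → Rules → Set
Exceptional V E = 7 ≤ length V × ∃ λ i → ∃ λ j → Realises (orbit (σᵗ i) (ρᵗ i) j) V E

exceptional? : ∀ V E → Dec (Exceptional V E)
exceptional? V E = (7 ≤? length V) ×-dec
  Fin.any? λ i → Fin.any? λ j → realises? Fin._≟_ (orbit (σᵗ i) (ρᵗ i) j) V E

-- Equivariant maps from SL₂(ℤ/N) to cosets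

data Trie : ℕ → Set where
  leaf   : Word → Trie 0
  branch : ∀ {k} → List (ℕ × Trie k) → Trie (suc k)

find : ∀ {k} → Trie k → Vec ℕ k → Maybe Word
find (leaf w)                []       = just w
find (branch [])             (x ∷ xs) = nothing
find (branch ((y , t) ∷ ts)) (x ∷ xs) = if x ≡ᵇ y then find t xs else find (branch ts) (x ∷ xs)

singleton : ∀ {k} → Vec ℕ k → Word → Trie k
singleton []       w = leaf w
singleton (x ∷ xs) w = branch ((x , singleton xs w) ∷ [])

mutual
  insert : ∀ {k} → Vec ℕ k → Word → Trie k → Trie k
  insert []       w _           = leaf w
  insert (x ∷ xs) w (branch ts) = branch (insertBranch x xs w ts)

  insertBranch : ∀ {k} → ℕ → Vec ℕ k → Word → List (ℕ × Trie k) → List (ℕ × Trie k)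
  insertBranch x xs w []             = (x , singleton xs w) ∷ []
  insertBranch x xs w ((y , t) ∷ ts) =
    if x ≡ᵇ y then (y , insert xs w t) ∷ ts else (y , t) ∷ insertBranch x xs w ts

_≟ᵐ_ : DecidableEquality (Maybe Word)
_≟ᵐ_ = Maybe.≡-dec _≟ʷ_

-- Matrices modulo N = suc m as vectors of residues; multiplication by m is negation.
module _ (m : ℕ) where
  private N = suc m

  act : Letter → Vec ℕ 4 → Vec ℕ 4
  act S (a ∷ b ∷ c ∷ d ∷ []) = c ℕ.* m % N ∷ d ℕ.* m % N ∷ a ∷ b ∷ []
  act R (a ∷ b ∷ c ∷ d ∷ []) = c ℕ.* m % N ∷ d ℕ.* m % N ∷ (a ℕ.+ c) % N ∷ (b ℕ.+ d) % N ∷ []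

  -- The residue is written `1 % N` because it is 0 when N = 1.
  unit : Vec ℕ 4
  unit = 1 % N ∷ 0 ∷ 0 ∷ 1 % N ∷ []

  module _ (E : Rules) where

    -- A depth-first walk from the entries of the work list. A matrix keeps the first word found for
    -- it; conflicts go unnoticed here and are detected by `equivariant?`.
    explore : ℕ → List (Vec ℕ 4 × Word) → Trie 4 → Trie 4
    explore zero    _                t = t
    explore (suc n) []               t = t
    explore (suc n) ((q , v) ∷ todo) t =
      if is-just (find t q) then explore n todo t
      else explore n ((act S q , reduce E (S ∷ v)) ∷ (act R q , reduce E (R ∷ v)) ∷ todo) (insert q v t)

    -- Vacuous for vectors absent from the trie, so that it can be tested on all quadruples of
    -- residues, including those of determinant other than 1.
    Compatible : Trie 4 → Vec ℕ 4 → Set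
    Compatible t q = Maybe.All (λ v → find t (act S q) ≡ just (reduce E (S ∷ v))
                                    × find t (act R q) ≡ just (reduce E (R ∷ v))) (find t q)

    compatible? : ∀ t q → Dec (Compatible t q)
    compatible? t q = Maybe.dec (λ v → (find t (act S q) ≟ᵐ just (reduce E (S ∷ v)))
                                 ×-dec (find t (act R q) ≟ᵐ just (reduce E (R ∷ v)))) (find t q)

    -- The trie is the graph of an equivariant map from SL₂(ℤ/N) to the cosets.
    record Equivariant (t : Trie 4) : Set where
      constructor equivariant
      field
        conditions : find t unit ≡ just []
          × (∀ {a} → a < N → ∀ {b} → b < N → ∀ {c} → c < N → ∀ {d} → d < N → Compatible t (a ∷ b ∷ c ∷ d ∷ []))

    equivariant? : ∀ t → Dec (Equivariant t)
    equivariant? t = map′ equivariant Equivariant.conditions ((find t unit ≟ᵐ just []) ×-dec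
      ℕ.allUpTo? (λ a → ℕ.allUpTo? (λ b → ℕ.allUpTo? (λ c → ℕ.allUpTo? (λ d →
        compatible? t (a ∷ b ∷ c ∷ d ∷ [])) N) N) N) N)

-- By Wohlfahrt's theorem the only candidate for the level is the order of T, which acts as SR;
-- the value returned is one less, and 0 if that order exceeds 7.
predLevel : List Word → Rules → ℕ
predLevel V E = fromMaybe 0 (head (filter fixes? (upTo 7)))
  where
  fixes? : ∀ k → Dec (All (λ v → fold v (λ v → reduceAll E v (S ∷ R ∷ [])) (suc k) ≡ v) V)
  fixes? k = All.all? (λ v → fold v (λ v → reduceAll E v (S ∷ R ∷ [])) (suc k) ≟ʷ v) V

-- The fuel exceeds 1 + 2 ∣SL₂(ℤ/7)∣ = 673.
cosetTrie : ℕ → Rules → Trie 4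
cosetTrie m E = explore m E 700 ((unit m , []) ∷ []) (branch [])

Congruence : List Word → Rules → Set
Congruence V E = Equivariant (predLevel V E) E (cosetTrie (predLevel V E) E)

congruence? : ∀ V E → Dec (Congruence V E)
congruence? V E = equivariant? (predLevel V E) E (cosetTrie (predLevel V E) E)

-- The low-index subgroups search

mutual
  -- A search tree of height at most n: every leaf is contradictory, too large, or complete and
  -- classified, and every inner node branches on the first missing edge.
  Covered : ℕ → List Word → Rules → Set
  Covered zero    V E = ⊥
  Covered (suc n) V E = ¬ Consistent V E
    ⊎ 7 < length V
    ⊎ Complete V E × (Exceptional V E ⊎ Congruence V E)
    ⊎ Branches n V E (missingEdges V E)

  Branches : ℕ → List Word → Rules → List Word → Set
  Branches n V E []      = ⊥
  -- A new vertex is named by the word u of the edge leading to it, hence the rule `(u , u)`.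
  Branches n V E (u ∷ _) = Covered n (u ∷ V) ((u , u) ∷ E) × All (λ v → Covered n V ((u , v) ∷ E)) V

mutual
  covered? : ∀ n V E → Dec (Covered n V E)
  covered? zero    V E = no λ ()
  covered? (suc n) V E = ¬? (consistent? V E)
    ⊎-dec 7 <? length V
    ⊎-dec complete? V E ×-dec (exceptional? V E ⊎-dec congruence? V E)
    ⊎-dec branches? n V E (missingEdges V E)

  branches? : ∀ n V E us → Dec (Branches n V E us)
  branches? n V E []      = no λ ()
  branches? n V E (u ∷ _) = covered? n (u ∷ V) ((u , u) ∷ E) ×-dec All.all? (λ v → covered? n V ((u , v) ∷ E)) V

-- A graph on 7 vertices has 14 edges, each using one unit of fuel.
search-succeeds : does (covered? 15 ([] ∷ []) []) ≡ true
search-succeeds = refl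

-- The hypothesis is checked by evaluating a Boolean, without evaluating the proof that accompanies
-- it.
witness : ∀ {A : Set} (A? : Dec A) → does A? ≡ true → A
witness (yes a) _ = a

abstract
  -- With the fuel hidden, the type `Covered k` cannot unfold into the whole search tree.
  covered : ∃ λ k → Covered k ([] ∷ []) []
  covered = 15 , witness (covered? 15 ([] ∷ []) []) search-succeeds

module _ {n} (n≤7 : n ≤ 7) {F : Word → Fin n} (F-cong : LeftCongruent F) (F-kills : KillsRelators F) where

  -- F selects one path through the search tree: at a missing edge u, either `F u` equals `F v` for
  -- a known vertex v, or u is a new vertex. `Realises` is preserved along the path and refutes the
  -- contradictory and the too large leaves.
  classify : ∀ k {V E} → Covered k V E → Realises F V E →
    ∃ λ V → ∃ λ E → Realises F V E × Complete V E × (Exceptional V E ⊎ Congruence V E)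
  classify (suc k) (inj₁ clash) real = contradiction (consistent F-cong real F-kills) clash
  classify (suc k) (inj₂ (inj₁ 7<∣V∣)) real = contradiction (ℕ.≤-trans (length≤ real) n≤7) (ℕ.<⇒≱ 7<∣V∣)
  classify (suc k) (inj₂ (inj₂ (inj₁ (complete , kind)))) real = _ , _ , real , complete , kind
  classify (suc k) {V} {E} (inj₂ (inj₂ (inj₂ branches))) real = go (missingEdges V E) branches
    where
    go : ∀ us → Branches k V E us → _
    go (u ∷ _) (new , old) with Any.any? (λ v → F u Fin.≟ F v) V
    ... | yes u∼V with v , v∈V , u∼v ← Membership.find u∼V =
      classify k (All.lookup old v∈V) (realises (Realises.distinct real) (u∼v ∷ Realises.sound real))
    ... | no ¬u∼V =
      classify k new (realises (All.¬Any⇒All¬ V ¬u∼V ∷ Realises.distinct real) (refl ∷ Realises.sound real))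

-- Congruence subgroups of small index

module _ (m : ℕ) where
  private N = suc m

  record Residue (z : ℤ) (q : ℕ) : Set where
    constructor residue
    field
      bounded   : q < N
      congruent : + N ∣ₛ z - + q

  residue-unique : ∀ {z p q} → Residue z p → Residue z q → p ≡ q
  residue-unique {z} {p} {q} (residue p<N N∣z-p) (residue q<N N∣z-q) =
    ℤ.+-injective (ℤ.i-j≡0⇒i≡j (+ p) (+ q) (ℤ.∣i∣≡0⇒i≡0 (small ∣ + p - + q ∣ ∣p-q∣<N N∣p-q)))
    where
    difference : ∀ z p q → (z - q) - (z - p) ≡ p - q
    difference = solve-∀
    N∣p-q : N ℕ.∣ ∣ + p - + q ∣
    N∣p-q = ℤ.∣⇒∣ᵤ (subst (+ N ∣ₛ_) (difference z (+ p) (+ q)) (ℤ.∣m∣n⇒∣m-n N∣z-q N∣z-p))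
    ∣p-q∣<N : ∣ + p - + q ∣ < N
    ∣p-q∣<N = ℕ.≤-<-trans (subst (λ x → ∣ x ∣ ≤ p ℕ.⊔ q) (sym (ℤ.m-n≡m⊖n p q)) (ℤ.∣m⊝n∣≤m⊔n p q)) (ℕ.⊔-lub p<N q<N)
    small : ∀ k → k < N → N ℕ.∣ k → k ≡ 0
    small zero    _   _   = refl
    small (suc k) k<N N∣k = contradiction N∣k (ℕ.>⇒∤ k<N)

  residue-% : ∀ {z} k → + N ∣ₛ z - + k → Residue z (k % N)
  residue-% {z} k N∣z-k = residue (m%n<n k N) (subst (+ N ∣ₛ_) (sym eq) (ℤ.∣m∣n⇒∣m+n N∣z-k (ℤ.divides (+ (k ℕ./ N)) refl)))
    where
    regroup : ∀ z r s → z - r ≡ (z - (r + s)) + s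
    regroup = solve-∀
    eq : z - + (k % N) ≡ (z - + k) + + (k ℕ./ N) * + N
    eq = trans (regroup z (+ (k % N)) (+ (k ℕ./ N) * + N))
      (cong (λ x → (z - x) + + (k ℕ./ N) * + N)
        (sym (trans (cong +_ (m≡m%n+[m/n]*n k N)) (cong (λ x → + (k % N) + x) (ℤ.pos-* (k ℕ./ N) N)))))

  Reduces : Mat → Vec ℕ 4 → Set
  Reduces (mat a b c d) (a′ ∷ b′ ∷ c′ ∷ d′ ∷ []) = Residue a a′ × Residue b b′ × Residue c c′ × Residue d d′

  residue-neg : ∀ {x z q} → x ≡ - z → Residue z q → Residue x (q ℕ.* m % N)
  residue-neg {x} {z} {q} refl (residue _ N∣z-q) = residue-% (q ℕ.* m)
    (subst (+ N ∣ₛ_) (sym (trans (cong (λ y → - z - y) (ℤ.pos-* q m)) (regroup z (+ q) (+ m))))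
      (ℤ.∣m∣n⇒∣m-n (ℤ.∣m⇒∣-m N∣z-q) (ℤ.divides (+ q) refl)))
    where
    regroup : ∀ z q m → - z - q * m ≡ - (z - q) - q * (1ℤ + m)
    regroup = solve-∀

  residue-+ : ∀ {x y z p q} → x ≡ y + z → Residue y p → Residue z q → Residue x ((p ℕ.+ q) % N)
  residue-+ {y = y} {z} {p} {q} refl (residue _ N∣y-p) (residue _ N∣z-q) = residue-% (p ℕ.+ q)
    (subst (+ N ∣ₛ_) (regroup y z (+ p) (+ q)) (ℤ.∣m∣n⇒∣m+n N∣y-p N∣z-q))
    where
    regroup : ∀ y z p q → (y - p) + (z - q) ≡ (y + z) - (p + q)
    regroup = solve-∀

  reduces-act : ∀ g {n q} → Reduces n q → Reduces (proj₁ ⟦ g ⟧ˡ ·ₘ n) (act m g q)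
  reduces-act g {mat a b c d} {a′ ∷ b′ ∷ c′ ∷ d′ ∷ []} (p , q , r , s) with g
  ... | S = residue-neg (top a c) r , residue-neg (top b d) s
          , subst (λ x → Residue x a′) (bottom a c) p , subst (λ x → Residue x b′) (bottom b d) q
    where
    bottom : ∀ x y → x ≡ 1ℤ * x + 0ℤ * y
    bottom = solve-∀
    top : ∀ x y → 0ℤ * x + -1ℤ * y ≡ - y
    top = solve-∀
  ... | R = residue-neg (top a c) r , residue-neg (top b d) s
          , residue-+ (bottom a c) p r , residue-+ (bottom b d) q s
    where
    bottom : ∀ x y → 1ℤ * x + 1ℤ * y ≡ x + y
    bottom = solve-∀
    top : ∀ x y → 0ℤ * x + -1ℤ * y ≡ - y
    top = solve-∀

  reduces-unit : ∀ A → InΓ N A → Reduces (proj₁ A) (unit m)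
  reduces-unit (mat a b c d , _) (p , q , r , s) =
    residue-% 1 (ℤ.∣ᵤ⇒∣ p) , residue-0 b q , residue-0 c r , residue-% 1 (ℤ.∣ᵤ⇒∣ s)
    where
    residue-0 : ∀ z → + N ∣ z → Residue z 0
    residue-0 z N∣z = residue (s≤s z≤n) (subst (+ N ∣ₛ_) (sym (ℤ.+-identityʳ z)) (ℤ.∣ᵤ⇒∣ N∣z))

  reduces-unique : ∀ {n p q} → Reduces n p → Reduces n q → p ≡ q
  reduces-unique {mat _ _ _ _} {_ ∷ _ ∷ _ ∷ _ ∷ []} {_ ∷ _ ∷ _ ∷ _ ∷ []} (p , q , r , s) (p′ , q′ , r′ , s′)
    rewrite residue-unique p p′ | residue-unique q q′ | residue-unique r r′ | residue-unique s s′ = refl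

  reduces-word : ∀ w → Reduces (proj₁ ⟦ w ⟧) (foldr (act m) (unit m) w)
  reduces-word []      = reduces-unit I₂ (N∣0 , N∣0 , N∣0 , N∣0)
    where N∣0 = N ℕ.∣0
  reduces-word (g ∷ w) = reduces-act g (reduces-word w)

  module _ {E : Rules} {t : Trie 4} (equiv : Equivariant m E t) where

    compatible : ∀ n q → Reduces n q → Compatible m E t q
    compatible (mat _ _ _ _) (_ ∷ _ ∷ _ ∷ _ ∷ []) (p , q , r , s) =
      proj₂ (Equivariant.conditions equiv) (Residue.bounded p) (Residue.bounded q) (Residue.bounded r) (Residue.bounded s)

    -- By induction on w: equivariance moves the matrix modulo N and the vertex along the same
    -- letter.
    find-word : ∀ w → find t (foldr (act m) (unit m) w) ≡ just (reduceAll E [] w)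
    find-word []      = proj₁ (Equivariant.conditions equiv)
    find-word (g ∷ w) = step g (Maybe.drop-just (subst (Maybe.All _) (find-word w)
                          (compatible (proj₁ ⟦ w ⟧) _ (reduces-word w))))
      where
      q = foldr (act m) (unit m) w
      v = reduceAll E [] w
      step : ∀ g → find t (act m S q) ≡ just (reduce E (S ∷ v)) × find t (act m R q) ≡ just (reduce E (R ∷ v)) →
             find t (act m g q) ≡ just (reduce E (g ∷ v))
      step S = proj₁
      step R = proj₂

    Γ⇒normalForm : ∀ w → InΓ N ⟦ w ⟧ → reduceAll E [] w ≡ []
    Γ⇒normalForm w ⟦w⟧∈Γ = Maybe.just-injective (begin
      just (reduceAll E [] w)                 ≡⟨ find-word w ⟨
      find t (foldr (act m) (unit m) w)       ≡⟨ cong (find t) (reduces-unique (reduces-word w) (reduces-unit ⟦ w ⟧ ⟦w⟧∈Γ)) ⟩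
      find t (unit m)                         ≡⟨ proj₁ (Equivariant.conditions equiv) ⟩
      just []                                 ∎)
      where open ≡-Reasoning

-- The Schreier graph of a subgroup

InΓ-resp-≈ : ∀ N {A B} → A ≈ B → InΓ N A → InΓ N B
InΓ-resp-≈ N refl p = p

-- Stated through words representing A, because the action is given here only on generators.
StabilisesIn : (SL2 → Set) → Fin 4 → Fin 7 → Set
StabilisesIn H i j = ∀ A w → ⟦ w ⟧ ≈ A →
  (H A → orbit (σᵗ i) (ρᵗ i) j w ≡ j) × (orbit (σᵗ i) (ρᵗ i) j w ≡ j → H A)

module _ {H : SL2 → Set} (H-sub : IsSubgroupΓ H) {n} (H-index : HasIndex H n) where
  open IsSubgroupΓ H-sub

  private
    f = proj₁ H-index

    f-complete : ∀ {A B} → H (inv A · B) → f A ≡ f B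
    f-complete {A} {B} = proj₂ (proj₁ (proj₂ H-index) A B)

    f-sound : ∀ {A B} → f A ≡ f B → H (inv A · B)
    f-sound {A} {B} = proj₁ (proj₁ (proj₂ H-index) A B)

  f-resp : ∀ {A B} → A ≈ B → f A ≡ f B
  f-resp {A} A≈B = f-complete (resp-∈ (trans (sym (inverseˡ A)) (cong (adj (proj₁ A) ·ₘ_) A≈B)) id-∈)

  f-neg : ∀ A → f (neg A) ≡ f A
  f-neg A = f-complete (resp-∈ {A = neg I₂} {B = inv (neg A) · A}
    (sym (trans (adj-negₘ-·ₘ (proj₁ A)) (cong negₘ (inverseˡ A)))) (neg-∈ id-∈))

  cosetOf : Word → Fin n
  cosetOf w = f ⟦ w ⟧

  cosetOf-cong : LeftCongruent cosetOf
  cosetOf-cong g {u} {v} eq = f-complete (resp-∈ (sym (·-cancel-inv ⟦ g ⟧ˡ ⟦ u ⟧ ⟦ v ⟧)) (f-sound eq))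

  cosetOf-kills : KillsRelators cosetOf
  cosetOf-kills = (λ v → trans (f-resp {B = neg ⟦ v ⟧} (S²·ₘ (proj₁ ⟦ v ⟧))) (f-neg ⟦ v ⟧))
                ∷ (λ v → trans (f-resp {B = neg ⟦ v ⟧} (R³·ₘ (proj₁ ⟦ v ⟧))) (f-neg ⟦ v ⟧))
                ∷ []

  ∈⇒coset : ∀ {A} w → ⟦ w ⟧ ≈ A → H A → cosetOf w ≡ cosetOf []
  ∈⇒coset w ⟦w⟧≈A A∈H = sym (f-complete (resp-∈ (sym (trans (·ₘ-identityˡ _) ⟦w⟧≈A)) A∈H))

  coset⇒∈ : ∀ {A} w → ⟦ w ⟧ ≈ A → cosetOf w ≡ cosetOf [] → H A
  coset⇒∈ w ⟦w⟧≈A eq = resp-∈ (trans (·ₘ-identityˡ _) ⟦w⟧≈A) (f-sound (sym eq))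

  -- In the exceptional case `cosetOf` and an orbit map realise the same complete graph, so a word
  -- represents an element of H exactly when it fixes j.
  classified⇒ : (∃ λ V → ∃ λ E → Realises cosetOf V E × Complete V E × (Exceptional V E ⊎ Congruence V E)) →
    IsCongruence H ⊎ (7 ≤ n × ∃ λ i → ∃ λ j → StabilisesIn H i j)
  classified⇒ (V , E , real , complete , inj₂ equiv) = inj₁ (suc (predLevel V E) , s≤s z≤n , λ A A∈Γ →
    let w , ⟦w⟧≈A = generated A in
    coset⇒∈ w ⟦w⟧≈A (normalForm⇒fixes cosetOf-cong real w
      (Γ⇒normalForm (predLevel V E) equiv w (InΓ-resp-≈ _ {A} {⟦ w ⟧} (sym ⟦w⟧≈A) A∈Γ))))
  classified⇒ (V , E , real , complete , inj₁ (7≤∣V∣ , i , j , realᵗ)) =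
    inj₂ (ℕ.≤-trans 7≤∣V∣ (length≤ real) , i , j , λ A w ⟦w⟧≈A →
      (λ A∈H → normalForm⇒fixes (orbit-cong (σᵗ i) (ρᵗ i) j) realᵗ w
                 (fixes⇒normalForm cosetOf-cong real complete w (∈⇒coset w ⟦w⟧≈A A∈H)))
    , (λ fix → coset⇒∈ w ⟦w⟧≈A (normalForm⇒fixes cosetOf-cong real w
                 (fixes⇒normalForm (orbit-cong (σᵗ i) (ρᵗ i) j) realᵗ complete w fix))))

  congruence-or-exceptional : n ≤ 7 → IsCongruence H ⊎ (7 ≤ n × ∃ λ i → ∃ λ j → StabilisesIn H i j)
  congruence-or-exceptional n≤7 =
    classified⇒ (classify n≤7 cosetOf-cong cosetOf-kills (proj₁ covered) (proj₂ covered) (realises ([] ∷ []) []))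

-- Noncongruence

module _ (N : ℕ) where

  infix 4 _≡ₙ_
  _≡ₙ_ : ℤ → ℤ → Set
  x ≡ₙ y = + N ∣ₛ (y - x)

  -- C⁻¹D - I = C⁻¹(D - C), and the entries of D - C are divisible by N.
  inv·∈Γ : ∀ (C D : SL2) (let m = proj₁ C; n = proj₁ D) →
    a m ≡ₙ a n → b m ≡ₙ b n → c m ≡ₙ c n → d m ≡ₙ d n → InΓ N (inv C · D)
  inv·∈Γ (mat a b c d , det≡1) (mat a′ b′ c′ d′ , _) p q r s =
      ℤ.∣⇒∣ᵤ (subst (+ N ∣ₛ_) (trans (e₁ a b c d a′ c′) (cong (λ x → d * a′ + (- b) * c′ - x) det≡1))
        (ℤ.∣m∣n⇒∣m-n (ℤ.∣n⇒∣m*n d p) (ℤ.∣n⇒∣m*n b r)))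
    , ℤ.∣⇒∣ᵤ (subst (+ N ∣ₛ_) (e₂ b d b′ d′) (ℤ.∣m∣n⇒∣m-n (ℤ.∣n⇒∣m*n d q) (ℤ.∣n⇒∣m*n b s)))
    , ℤ.∣⇒∣ᵤ (subst (+ N ∣ₛ_) (e₃ a c a′ c′) (ℤ.∣m∣n⇒∣m-n (ℤ.∣n⇒∣m*n a r) (ℤ.∣n⇒∣m*n c p)))
    , ℤ.∣⇒∣ᵤ (subst (+ N ∣ₛ_) (trans (e₄ a b c d b′ d′) (cong (λ x → (- c) * b′ + a * d′ - x) det≡1))
        (ℤ.∣m∣n⇒∣m-n (ℤ.∣n⇒∣m*n a s) (ℤ.∣n⇒∣m*n c q)))
    where
    e₁ : ∀ a b c d a′ c′ → d * (a′ - a) - b * (c′ - c) ≡ d * a′ + (- b) * c′ - (a * d - b * c)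
    e₁ = solve-∀
    e₂ : ∀ b d b′ d′ → d * (b′ - b) - b * (d′ - d) ≡ d * b′ + (- b) * d′
    e₂ = solve-∀
    e₃ : ∀ a c a′ c′ → a * (c′ - c) - c * (a′ - a) ≡ (- c) * a′ + a * c′
    e₃ = solve-∀
    e₄ : ∀ a b c d b′ d′ → a * (d′ - d) - c * (b′ - b) ≡ (- c) * b′ + a * d′ - (a * d - b * c)
    e₄ = solve-∀

  -- For U = `upper x` and L = `lower (- y)`, the difference LU - UL is the diagonal matrix with
  -- entries xy and -xy.
  commutator∈Γ : ∀ x y B → + N ∣ₛ x * y →
    InΓ N (inv (upper x · (lower (- y) · B)) · (lower (- y) · (upper x · B)))
  commutator∈Γ x y B@(mat a b c d , _) N∣xy = inv·∈Γ (upper x · (lower (- y) · B)) (lower (- y) · (upper x · B))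
    (subst (+ N ∣ₛ_) (top x y a c) (ℤ.∣m⇒∣m*n a N∣xy))
    (subst (+ N ∣ₛ_) (top x y b d) (ℤ.∣m⇒∣m*n b N∣xy))
    (subst (+ N ∣ₛ_) (bottom x y a c) (ℤ.∣m⇒∣m*n (- c) N∣xy))
    (subst (+ N ∣ₛ_) (bottom x y b d) (ℤ.∣m⇒∣m*n (- d) N∣xy))
    where
    top : ∀ x y a c → x * y * a ≡
      (1ℤ * (1ℤ * a + x * c) + 0ℤ * (0ℤ * a + 1ℤ * c)) - (1ℤ * (1ℤ * a + 0ℤ * c) + x * ((- y) * a + 1ℤ * c))
    top = solve-∀
    bottom : ∀ x y a c → x * y * (- c) ≡
      ((- y) * (1ℤ * a + x * c) + 1ℤ * (0ℤ * a + 1ℤ * c)) - (0ℤ * (1ℤ * a + 0ℤ * c) + 1ℤ * ((- y) * a + 1ℤ * c))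
    bottom = solve-∀

halve : ∀ n → ∃ λ h → n ≡ h ℕ.+ h ⊎ n ≡ suc (h ℕ.+ h)
halve zero = 0 , inj₁ refl
halve (suc n) with halve n
... | h , inj₁ p = h , inj₂ (cong suc p)
... | h , inj₂ p = suc h , inj₁ (cong suc (trans p (sym (ℕ.+-suc h h))))

Splits : ℕ → Set
Splits N = ∃ λ q → ∃ λ r → N ℕ.∣ (q ℕ.* 60 ℕ.+ 16) ℕ.* (r ℕ.* 60 ℕ.+ 15)

-- The two factors collect the even and the odd part of N; 16² ≡ 16 and 15 k² ≡ 15 modulo 60 for odd k.
splits : ∀ N → 1 ≤ N → Splits N
splits N 1≤N = go N N ℕ.≤-refl 1≤N
  where
  go : ∀ n N → N ≤ n → 1 ≤ N → Splits N
  go zero    N N≤n 1≤N = contradiction (ℕ.≤-trans 1≤N N≤n) λ ()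
  go (suc n) N N≤n 1≤N with halve N
  -- For N = 2h + 1, the second factor 60h(h + 1) + 15 is 15N².
  ... | h , inj₂ refl = 0 , h ℕ.* suc h , ℕ.divides (16 ℕ.* (15 ℕ.* suc (h ℕ.+ h))) (odd h)
    where
    odd : ∀ h → 16 ℕ.* (h ℕ.* (1 ℕ.+ h) ℕ.* 60 ℕ.+ 15) ≡ 16 ℕ.* (15 ℕ.* (1 ℕ.+ (h ℕ.+ h))) ℕ.* (1 ℕ.+ (h ℕ.+ h))
    odd = ℕ.solve-∀
  ... | zero , inj₁ refl = contradiction 1≤N λ ()
  ... | suc h , inj₁ refl with go n (suc h) (ℕ.≤-trans (ℕ.m≤n+m (suc h) h) (ℕ.s≤s⁻¹ N≤n)) (s≤s z≤n)
  -- The first factor is multiplied by 16: 16(60q + 16) = 60(16q + 4) + 16.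
  ...   | q , r , ℕ.divides k eq = 16 ℕ.* q ℕ.+ 4 , r , ℕ.divides (8 ℕ.* k)
          (trans (double q (r ℕ.* 60 ℕ.+ 15)) (trans (cong (16 ℕ.*_) eq) (regroup k (suc h))))
    where
    double : ∀ q y → ((16 ℕ.* q ℕ.+ 4) ℕ.* 60 ℕ.+ 16) ℕ.* y ≡ 16 ℕ.* ((q ℕ.* 60 ℕ.+ 16) ℕ.* y)
    double = ℕ.solve-∀
    regroup : ∀ k h → 16 ℕ.* (k ℕ.* h) ≡ 8 ℕ.* k ℕ.* (h ℕ.+ h)
    regroup = ℕ.solve-∀

words : ℕ → List Word
words zero    = [] ∷ []
words (suc n) = map (S ∷_) (words n) ++ map (R ∷_) (words n)

-- As S³ = S⁻¹, these words represent T and RS⁻¹ = STS⁻¹ = `lower -1ℤ`.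
T-word L-word : Word
T-word = S ∷ S ∷ S ∷ R ∷ []
L-word = R ∷ S ∷ S ∷ S ∷ []

power : Fin 4 → Word → ℕ → Fin 7 → Fin 7
power i w n j = fold j (λ k → orbit (σᵗ i) (ρᵗ i) k w) n

abstract
  σᵗ-involutive : ∀ i j → σᵗ i (σᵗ i j) ≡ j
  σᵗ-involutive = witness (Fin.all? λ i → Fin.all? λ j → σᵗ i (σᵗ i j) Fin.≟ j) refl

  -- Every ρᵗ i fixes 0, so shorter words can be padded with R to length 7.
  orbit-surjective : ∀ i k → ∃ λ w → orbit (σᵗ i) (ρᵗ i) (# 0) w ≡ k
  orbit-surjective i k = Any.satisfied (witness (Fin.all? λ i → Fin.all? λ k →
    Any.any? (λ w → orbit (σᵗ i) (ρᵗ i) (# 0) w Fin.≟ k) (words 7)) refl i k)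

  -- T has cycle types 4+3, 5+2, 6+1 and 6+1 in the four actions, hence orders 12, 10, 6 and 6 with
  -- least common multiple 60; L is conjugate to T.
  power-60 : ∀ i k → power i T-word 60 k ≡ k × power i L-word 60 k ≡ k
  power-60 = witness (Fin.all? λ i → Fin.all? λ k →
    (power i T-word 60 k Fin.≟ k) ×-dec (power i L-word 60 k Fin.≟ k)) refl

  noncommuting : ∀ i → power i T-word 16 (power i L-word 15 (# 1)) ≢ power i L-word 15 (power i T-word 16 (# 1))
  noncommuting = witness (Fin.all? λ i →
    ¬? (power i T-word 16 (power i L-word 15 (# 1)) Fin.≟ power i L-word 15 (power i T-word 16 (# 1)))) refl

fold-periodic : ∀ {A : Set} {s : A → A} p → (∀ z → fold z s p ≡ z) → ∀ q r z → fold z s (q ℕ.* p ℕ.+ r) ≡ fold z s r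
fold-periodic {s = s} p period q r z = trans (fold-+ z s (q ℕ.* p)) (go q (fold z s r))
  where
  go : ∀ q z → fold z s (q ℕ.* p) ≡ z
  go zero    z = refl
  go (suc q) z = trans (fold-+ z s p) (trans (cong (λ x → fold x s p) (go q z)) (period z))

-- Point stabilisers of the four homomorphisms

module _ (i : Fin 4) {φ : SL2 → Fin 7 → Fin 7} (φ-hom : IsHomΓ (σᵗ i) (ρᵗ i) φ) where
  open IsHomΓ φ-hom

  -- The values of φ are arbitrary functions a priori; S² = -I and σ² = 1 force this one to be the
  -- identity.
  φ-I : ∀ j → φ I₂ j ≡ j
  φ-I j = begin
    φ I₂ j               ≡⟨ neg-inv I₂ j ⟨
    φ (neg I₂) j         ≡⟨ resp-φ {neg I₂} {Sₘ · Sₘ} refl j ⟩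
    φ (Sₘ · Sₘ) j        ≡⟨ hom Sₘ Sₘ j ⟩
    φ Sₘ (φ Sₘ j)        ≡⟨ on-S _ ⟩
    σᵗ i (φ Sₘ j)        ≡⟨ cong (σᵗ i) (on-S j) ⟩
    σᵗ i (σᵗ i j)        ≡⟨ σᵗ-involutive i j ⟩
    j                    ∎
    where open ≡-Reasoning

  φ-word : ∀ w j → φ ⟦ w ⟧ j ≡ orbit (σᵗ i) (ρᵗ i) j w
  φ-word []      j = φ-I j
  φ-word (S ∷ w) j = trans (hom Sₘ ⟦ w ⟧ j) (trans (on-S _) (cong (σᵗ i) (φ-word w j)))
  φ-word (R ∷ w) j = trans (hom Rₘ ⟦ w ⟧ j) (trans (on-R _) (cong (ρᵗ i) (φ-word w j)))

  φ-inverse : ∀ A j → φ (inv A) (φ A j) ≡ j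
  φ-inverse A j = trans (sym (hom (inv A) A j)) (trans (resp-φ {inv A · A} {I₂} (inverseˡ A) j) (φ-I j))

  φ-injective : ∀ A {j k} → φ A j ≡ φ A k → j ≡ k
  φ-injective A {j} {k} eq = trans (sym (φ-inverse A j)) (trans (cong (φ (inv A)) eq) (φ-inverse A k))

  -- Each point is reached from `# 0`, so one goes from j back to `# 0` and on to k.
  φ-transitive : ∀ j k → ∃ λ A → φ A j ≡ k
  φ-transitive j k with orbit-surjective i j | orbit-surjective i k
  ... | u , u·0≡j | v , v·0≡k = ⟦ v ⟧ · inv ⟦ u ⟧ , (begin
    φ (⟦ v ⟧ · inv ⟦ u ⟧) j                    ≡⟨ hom ⟦ v ⟧ (inv ⟦ u ⟧) j ⟩
    φ ⟦ v ⟧ (φ (inv ⟦ u ⟧) j)                  ≡⟨ cong (λ x → φ ⟦ v ⟧ (φ (inv ⟦ u ⟧) x)) (trans (φ-word u (# 0)) u·0≡j) ⟨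
    φ ⟦ v ⟧ (φ (inv ⟦ u ⟧) (φ ⟦ u ⟧ (# 0)))    ≡⟨ cong (φ ⟦ v ⟧) (φ-inverse ⟦ u ⟧ (# 0)) ⟩
    φ ⟦ v ⟧ (# 0)                              ≡⟨ φ-word v (# 0) ⟩
    orbit (σᵗ i) (ρᵗ i) (# 0) v                ≡⟨ v·0≡k ⟩
    k                                          ∎)
    where open ≡-Reasoning

  φ-fixes⇒ : ∀ A B j → φ (inv A · B) j ≡ j → φ A j ≡ φ B j
  φ-fixes⇒ A B j eq = φ-injective (inv A) (trans (φ-inverse A j) (trans (sym eq) (hom (inv A) B j)))

  stabiliser-index : ∀ j → HasIndex (StabPre φ j) 7
  stabiliser-index j = (λ A → φ A j)
    , (λ A B → (λ eq → trans (hom (inv A) B j) (trans (cong (φ (inv A)) (sym eq)) (φ-inverse A j))) , φ-fixes⇒ A B j)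
    , φ-transitive j

  φ-upper : ∀ n k → φ (upper (+ n)) k ≡ power i T-word n k
  φ-upper zero    k = φ-I k
  φ-upper (suc n) k = begin
    φ (upper (+ suc n)) k                ≡⟨ resp-φ {⟦ T-word ⟧ · upper (+ n)} {upper (+ suc n)} (upper-+ 1ℤ (+ n)) k ⟨
    φ (⟦ T-word ⟧ · upper (+ n)) k       ≡⟨ hom ⟦ T-word ⟧ (upper (+ n)) k ⟩
    φ ⟦ T-word ⟧ (φ (upper (+ n)) k)     ≡⟨ φ-word T-word _ ⟩
    orbit (σᵗ i) (ρᵗ i) (φ (upper (+ n)) k) T-word ≡⟨ cong (λ x → orbit (σᵗ i) (ρᵗ i) x T-word) (φ-upper n k) ⟩
    power i T-word (suc n) k             ∎
    where open ≡-Reasoning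

  φ-lower : ∀ n k → φ (lower (- + n)) k ≡ power i L-word n k
  φ-lower zero    k = φ-I k
  φ-lower (suc n) k = begin
    φ (lower (- + suc n)) k              ≡⟨ resp-φ {⟦ L-word ⟧ · lower (- + n)} {lower (- + suc n)}
                                              (trans (lower-+ -1ℤ (- + n)) (cong (λ x → mat 1ℤ 0ℤ x 1ℤ) (sym (ℤ.neg-distrib-+ 1ℤ (+ n))))) k ⟨
    φ (⟦ L-word ⟧ · lower (- + n)) k     ≡⟨ hom ⟦ L-word ⟧ (lower (- + n)) k ⟩
    φ ⟦ L-word ⟧ (φ (lower (- + n)) k)   ≡⟨ φ-word L-word _ ⟩
    orbit (σᵗ i) (ρᵗ i) (φ (lower (- + n)) k) L-word ≡⟨ cong (λ x → orbit (σᵗ i) (ρᵗ i) x L-word) (φ-lower n k) ⟩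
    power i L-word (suc n) k             ∎
    where open ≡-Reasoning

  -- Write k = `φ B j`. The matrices ULB and LUB lie in the same left coset of Γ(N), which fixes j,
  -- so they send j to the same point.
  commuting-powers : ∀ N j → (∀ A → InΓ N A → φ A j ≡ j) → ∀ x y → + N ∣ₛ x * y → ∀ k →
    φ (upper x) (φ (lower (- y)) k) ≡ φ (lower (- y)) (φ (upper x) k)
  commuting-powers N j Γ⊆ x y N∣xy k = go (φ-transitive j k)
    where
    open ≡-Reasoning
    U = upper x
    L = lower (- y)
    go : (∃ λ B → φ B j ≡ k) → φ U (φ L k) ≡ φ L (φ U k)
    go (B , Bj≡k) = begin
      φ U (φ L k)        ≡⟨ cong (λ z → φ U (φ L z)) Bj≡k ⟨
      φ U (φ L (φ B j))  ≡⟨ trans (hom U (L · B) j) (cong (φ U) (hom L B j)) ⟨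
      φ (U · (L · B)) j  ≡⟨ φ-fixes⇒ (U · (L · B)) (L · (U · B)) j
                              (Γ⊆ (inv (U · (L · B)) · (L · (U · B))) (commutator∈Γ N x y B N∣xy)) ⟩
      φ (L · (U · B)) j  ≡⟨ trans (hom L (U · B) j) (cong (φ L) (hom U B j)) ⟩
      φ L (φ U (φ B j))  ≡⟨ cong (λ z → φ L (φ U z)) Bj≡k ⟩
      φ L (φ U k)        ∎

  φ-upper-16 : ∀ q k → φ (upper (+ (q ℕ.* 60 ℕ.+ 16))) k ≡ power i T-word 16 k
  φ-upper-16 q k = trans (φ-upper _ k) (fold-periodic 60 (λ z → proj₁ (power-60 i z)) q 16 k)

  φ-lower-15 : ∀ r k → φ (lower (- + (r ℕ.* 60 ℕ.+ 15))) k ≡ power i L-word 15 k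
  φ-lower-15 r k = trans (φ-lower _ k) (fold-periodic 60 (λ z → proj₂ (power-60 i z)) r 15 k)

  stabiliser-noncongruence : ∀ j → ¬ IsCongruence (StabPre φ j)
  stabiliser-noncongruence j (N , 1≤N , Γ⊆) = go (splits N 1≤N)
    where
    go : Splits N → ⊥
    go (q , r , N∣xy) = noncommuting i (trans
      (sym (trans (φ-upper-16 q _) (cong (power i T-word 16) (φ-lower-15 r (# 1)))))
      (trans (commuting-powers N j Γ⊆ (+ x) (+ y) (ℤ.∣ᵤ⇒∣ (subst (N ℕ.∣_) (sym (ℤ.abs-* (+ x) (+ y))) N∣xy)) (# 1))
        (trans (φ-lower-15 r _) (cong (power i L-word 15) (φ-upper-16 q (# 1))))))
      where
      x = q ℕ.* 60 ℕ.+ 16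
      y = r ℕ.* 60 ℕ.+ 15

-- The classification in index at most 7

IsCongruence-resp-≐ : ∀ {H K} → H ≐ K → IsCongruence H → IsCongruence K
IsCongruence-resp-≐ H≐K (N , 1≤N , Γ⊆H) = N , 1≤N , λ A A∈Γ → proj₁ (H≐K A) (Γ⊆H A A∈Γ)

theorem2p1 : (φ₁ φ₂ φ₃ φ₄ : SL2 → Fin 7 → Fin 7) →
    IsHomΓ σ₁ ρ₁ φ₁ → IsHomΓ σ₁ ρ₂ φ₂ → IsHomΓ σ₃ ρ₁ φ₃ → IsHomΓ σ₃ ρ₄ φ₄ →
    (∀ H → IsSubgroupΓ H → ∀ n → n < 7 → HasIndex H n → IsCongruence H)
    × (∀ H → IsSubgroupΓ H → HasIndex H 7 →
    ((¬ IsCongruence H) →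
    ∃ λ j → (H ≐ StabPre φ₁ j) ⊎ (H ≐ StabPre φ₂ j) ⊎ (H ≐ StabPre φ₃ j) ⊎ (H ≐ StabPre φ₄ j))
    × ((∃ λ j → (H ≐ StabPre φ₁ j) ⊎ (H ≐ StabPre φ₂ j) ⊎ (H ≐ StabPre φ₃ j) ⊎ (H ≐ StabPre φ₄ j)) →
    ¬ IsCongruence H))
    × (∀ j →
    (HasIndex (StabPre φ₁ j) 7 × ¬ IsCongruence (StabPre φ₁ j))
    × (HasIndex (StabPre φ₂ j) 7 × ¬ IsCongruence (StabPre φ₂ j))
    × (HasIndex (StabPre φ₃ j) 7 × ¬ IsCongruence (StabPre φ₃ j))
    × (HasIndex (StabPre φ₄ j) 7 × ¬ IsCongruence (StabPre φ₄ j)))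
theorem2p1 φ₁ φ₂ φ₃ φ₄ hom₁ hom₂ hom₃ hom₄ =
    small
  , (λ H H-sub H-index → exceptional H H-sub H-index , noncongruence H)
  , λ j → both (# 0) hom₁ j , both (# 1) hom₂ j , both (# 2) hom₃ j , both (# 3) hom₄ j
  where
  both : ∀ i {φ} → IsHomΓ (σᵗ i) (ρᵗ i) φ → ∀ j → HasIndex (StabPre φ j) 7 × ¬ IsCongruence (StabPre φ j)
  both i hom j = stabiliser-index i hom j , stabiliser-noncongruence i hom j

  small : ∀ H → IsSubgroupΓ H → ∀ n → n < 7 → HasIndex H n → IsCongruence H
  small H H-sub n n<7 H-index = [ id , (λ (7≤n , _) → contradiction 7≤n (ℕ.<⇒≱ n<7)) ]′
    (congruence-or-exceptional H-sub H-index (ℕ.<⇒≤ n<7))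

  Listed : (SL2 → Set) → Set
  Listed H = ∃ λ j → (H ≐ StabPre φ₁ j) ⊎ (H ≐ StabPre φ₂ j) ⊎ (H ≐ StabPre φ₃ j) ⊎ (H ≐ StabPre φ₄ j)

  noncongruence : ∀ H → Listed H → ¬ IsCongruence H
  noncongruence H (j , inj₁ p)               = stabiliser-noncongruence (# 0) hom₁ j ∘ IsCongruence-resp-≐ p
  noncongruence H (j , inj₂ (inj₁ p))        = stabiliser-noncongruence (# 1) hom₂ j ∘ IsCongruence-resp-≐ p
  noncongruence H (j , inj₂ (inj₂ (inj₁ p))) = stabiliser-noncongruence (# 2) hom₃ j ∘ IsCongruence-resp-≐ p
  noncongruence H (j , inj₂ (inj₂ (inj₂ p))) = stabiliser-noncongruence (# 3) hom₄ j ∘ IsCongruence-resp-≐ p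

  exceptional : ∀ H → IsSubgroupΓ H → HasIndex H 7 → ¬ IsCongruence H → Listed H
  exceptional H H-sub H-index ¬congruence =
    [ (λ congruence → contradiction congruence ¬congruence) , (λ (_ , i , j , equal) → j , place i j equal) ]′
      (congruence-or-exceptional H-sub H-index ℕ.≤-refl)
    where
    stabiliser : ∀ i {φ} → IsHomΓ (σᵗ i) (ρᵗ i) φ → ∀ j → StabilisesIn H i j → H ≐ StabPre φ j
    stabiliser i {φ} hom j equal A =
      let w , ⟦w⟧≈A = generated A
          φA≡ = trans (sym (IsHomΓ.resp-φ hom {⟦ w ⟧} {A} ⟦w⟧≈A j)) (φ-word i hom w j)
          to , from = equal A w ⟦w⟧≈A
      in (λ A∈H → trans φA≡ (to A∈H)) , (λ fix → from (trans (sym φA≡) fix))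

    place : ∀ i j → StabilisesIn H i j →
      (H ≐ StabPre φ₁ j) ⊎ (H ≐ StabPre φ₂ j) ⊎ (H ≐ StabPre φ₃ j) ⊎ (H ≐ StabPre φ₄ j)
    place Fin.zero                               j = inj₁ ∘ stabiliser (# 0) hom₁ j
    place (Fin.suc Fin.zero)                     j = inj₂ ∘ inj₁ ∘ stabiliser (# 1) hom₂ j
    place (Fin.suc (Fin.suc Fin.zero))           j = inj₂ ∘ inj₂ ∘ inj₁ ∘ stabiliser (# 2) hom₃ j
    place (Fin.suc (Fin.suc (Fin.suc Fin.zero))) j = inj₂ ∘ inj₂ ∘ inj₂ ∘ stabiliser (# 3) hom₄ j
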